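{- Every ordered matching on $2n$ vertices contains a line, a stack, or a wave of size at least $n^{1/3}$.
   Context: Here $n$ is a positive integer. An ordered matching of size $n$ is a graph on a linearly ordered vertex set $V$ with $|V|=2n$ (say $V=\{1,\dots,2n\}$) consisting of $n$ pairwise vertex-disjoint edges (so there are no isolated vertices). The size of a matching is its number of edges. A sub-matching is a subset of the edges, its vertices inheriting the linear order. A matching with $k$ edges $\{a_i,b_i\}$, $a_i<b_i$, $i=1,\dots,k$, numbered so that $a_1<\cdots<a_k$, is called: a line if $a_1<b_1<a_2<b_2<\cdots<a_k<b_k$; a stack if $a_1<a_2<\cdots<a_k<b_k<b_{k-1}<\cdots<b_1$; a wave if $a_1<a_2<\cdots<a_k<b_1<b_2<\cdots<b_k$. A matching contains a line (stack, wave) if some sub-matching of it is a line (stack, wave). -}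

module Defs where

open import Data.Nat.Base using (ℕ; _*_)
open import Data.Fin.Base using (Fin; _<_)
open import Data.List.Base using (List; []; _∷_; _++_; map; concatMap; reverse; length)
open import Data.List.Membership.Propositional using (_∈_)
open import Data.List.Relation.Binary.Disjoint.Propositional using (Disjoint)
open import Data.List.Relation.Binary.Permutation.Propositional using (_↭_)
open import Data.List.Relation.Binary.Subset.Propositional using (_⊆_)
open import Data.List.Relation.Unary.AllPairs using (AllPairs)
open import Data.List.Relation.Unary.Linked using (Linked)
open import Data.Product.Base using (_×_; ∃-syntax)
open import Relation.Binary.PropositionalEquality using (_≡_)

record Edge (m : ℕ) : Set where
  constructor edge
  field
    left       : Fin m
    right      : Fin m
    left<right : left < right

open Edge public

endpoints : ∀ {m} → Edge m → List (Fin m)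
endpoints e = left e ∷ right e ∷ []

VertexDisjoint : ∀ {m} → Edge m → Edge m → Set
VertexDisjoint e f = Disjoint (endpoints e) (endpoints f)

-- The order in which the edges are listed carries no meaning; pairwise
-- disjointness rules out repetitions, so `edges` enumerates a set of k edges.
-- Elements of Fin m not covered by an edge are not vertices of the matching:
-- Fin m only supplies the linear order, so that a sub-matching inherits it.
record Matching (m k : ℕ) : Set where
  field
    edges    : List (Edge m)
    size     : length edges ≡ k
    disjoint : AllPairs VertexDisjoint edges

open Matching public

-- Since n disjoint edges have 2n endpoints, every element of Fin (2 * n) is
-- covered.
OrderedMatching : ℕ → Set
OrderedMatching n = Matching (2 * n) n

IsSubMatching : ∀ {m k n} → Matching m k → Matching m n → Set
IsSubMatching M′ M = edges M′ ⊆ edges M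

-- es numbers the edges of M so that a₁ < a₂ < ⋯ < aₖ.
IsNumbering : ∀ {m k} → Matching m k → List (Edge m) → Set
IsNumbering M es = es ↭ edges M × Linked _<_ (map left es)

-- a₁ < b₁ < a₂ < b₂ < ⋯ < aₖ < bₖ
IsLine : ∀ {m k} → Matching m k → Set
IsLine M = ∃[ es ] IsNumbering M es × Linked _<_ (concatMap endpoints es)

-- a₁ < ⋯ < aₖ < bₖ < ⋯ < b₁
IsStack : ∀ {m k} → Matching m k → Set
IsStack M = ∃[ es ] IsNumbering M es × Linked _<_ (map left es ++ reverse (map right es))

-- a₁ < ⋯ < aₖ < b₁ < ⋯ < bₖ
IsWave : ∀ {m k} → Matching m k → Set
IsWave M = ∃[ es ] IsNumbering M es × Linked _<_ (map left es ++ map right es)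

ContainsLine ContainsStack ContainsWave : ∀ {m n} → ℕ → Matching m n → Set
ContainsLine  {m} k M = ∃[ M′ ] IsSubMatching {m} {k} M′ M × IsLine M′
ContainsStack {m} k M = ∃[ M′ ] IsSubMatching {m} {k} M′ M × IsStack M′
ContainsWave  {m} k M = ∃[ M′ ] IsSubMatching {m} {k} M′ M × IsWave M′

{-# OPTIONS --safe #-}

-- Order the edges by their left endpoints. Of two edges, the earlier one precedes,
-- nests or crosses the later one, and precedence and nesting are transitive. If Q
-- is transitive and P ∪ Q holds between any two elements of a sequence of length
-- n, then n ≤ c l for a Q-chain of length c and a P-clique of length l (greedy
-- layering). Taking for Q first precedence and then nesting leaves pairwise
-- crossing edges as the last clique, so n ≤ (line)(stack)(wave). Crossing is not
-- transitive, which is why it only ever plays the part of P.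
module Submission where

open import Defs
open import Data.Nat.Base using (ℕ; _≤_; _^_; NonZero; suc; _+_; _*_; z≤n)
open import Data.Nat.Properties as ℕ using ()
open import Data.Fin.Base using (_<_)
open import Data.Fin.Properties as Fin using ()
open import Data.List.Base using (List; []; _∷_; _++_; map; concat; reverse; length)
open import Data.List.Properties using (length-++; unfold-reverse)
open import Data.List.Relation.Binary.Disjoint.Propositional.Properties using (sym)
open import Data.List.Relation.Binary.Permutation.Propositional using (_↭_; ↭-refl; ↭-sym; ↭⇒↭ₛ)
open import Data.List.Relation.Binary.Permutation.Propositional.Properties
  using (All-resp-↭; Any-resp-↭; ↭-reverse; ↭-length)
open import Data.List.Relation.Binary.Permutation.Setoid.Properties using (AllPairs-resp-↭)
open import Data.List.Relation.Binary.Sublist.Propositional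
  using (_⊆_; []; _∷_; _∷ʳ_; lookup; minimum; ⊆-trans)
open import Data.List.Relation.Binary.Sublist.Propositional.Properties using (All-resp-⊆)
open import Data.List.Relation.Unary.All as All using (All; []; _∷_)
open import Data.List.Relation.Unary.All.Properties as All using ()
open import Data.List.Relation.Unary.AllPairs as AllPairs using (AllPairs; []; _∷_)
open import Data.List.Relation.Unary.AllPairs.Properties as AllPairs using ()
open import Data.List.Relation.Unary.Any using (Any; here; there)
open import Data.List.Relation.Unary.Linked.Properties using (AllPairs⇒Linked; Linked⇒AllPairs)
open import Data.List.Sort using (sort; sort-↭; sort-↗)
open import Data.Product.Base using (_×_; ∃-syntax; _,_; proj₁; proj₂; map₂)
open import Data.Sum.Base using (_⊎_; inj₁; inj₂)
open import Function.Base using (_∘_; flip; _on_)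
open import Level using (0ℓ)
open import Relation.Binary.Bundles using (DecTotalOrder)
open import Relation.Binary.Construct.On as On using ()
open import Relation.Binary.Core using (Rel)
open import Relation.Binary.Definitions using (Reflexive; Transitive; tri<; tri≈; tri>)
open import Relation.Binary.PropositionalEquality
  using (_≡_; refl; trans; cong; subst; resp₂; setoid)
import Relation.Binary.PropositionalEquality as ≡
open import Relation.Nullary using (contradiction)
open import Relation.Unary using (Pred)

-- Pairwise relations on lists.

module _ {A : Set} where

  AllPairs-resp-⊇ : {R : Rel A 0ℓ} {xs ys : List A} → ys ⊆ xs → AllPairs R xs → AllPairs R ys
  AllPairs-resp-⊇ []         []         = []
  AllPairs-resp-⊇ (_ ∷ʳ τ)   (_ ∷ rs)   = AllPairs-resp-⊇ τ rs
  AllPairs-resp-⊇ (refl ∷ τ) (r ∷ rs)   = All-resp-⊆ τ r ∷ AllPairs-resp-⊇ τ rs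

  AllPairs-reverse⁺ : {R : Rel A 0ℓ} {xs : List A} → AllPairs R xs → AllPairs (flip R) (reverse xs)
  AllPairs-reverse⁺ []                           = []
  AllPairs-reverse⁺ {R} {x ∷ xs} (r ∷ rs)
    rewrite unfold-reverse x xs =
    AllPairs.++⁺ (AllPairs-reverse⁺ rs) ([] ∷ [])
      (All.map (_∷ []) (All-resp-↭ (↭-sym (↭-reverse xs)) r))

  -- `AllPairs` compares an element only with later ones. The hypothesis on `R` gives `S` in both
  -- orders and reflexivity gives the diagonal, so the triangle fills up to a square.
  AllPairs⇒All² : {R S : Rel A 0ℓ} → Reflexive S → (∀ {x y} → R x y → S x y × S y x) →
                  ∀ {xs} → AllPairs R xs → All (λ x → All (S x) xs) xs
  AllPairs⇒All² S-refl R⇒S []       = []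
  AllPairs⇒All² S-refl R⇒S (r ∷ rs) =
    (S-refl ∷ All.map (proj₁ ∘ R⇒S) r) ∷
    All.zipWith (λ (Rxy , Sy) → proj₂ (R⇒S Rxy) ∷ Sy) (r , AllPairs⇒All² S-refl R⇒S rs)

  All-⊎ : {P Q : Pred A 0ℓ} {xs : List A} → All (λ x → P x ⊎ Q x) xs → All P xs ⊎ Any Q xs
  All-⊎ []             = inj₁ []
  All-⊎ (inj₂ q ∷ _)   = inj₂ (here q)
  All-⊎ (inj₁ p ∷ pqs) with All-⊎ pqs
  ... | inj₁ ps = inj₁ (p ∷ ps)
  ... | inj₂ q  = inj₂ (there q)

-- Layering a list by the length of chains.

module Layering {A : Set} {P Q : Rel A 0ℓ} (Q-trans : Transitive Q) where

  -- `i` counts the elements after `x`, so the whole chain has `suc i` elements and layers are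
  -- numbered from 0.
  ChainFrom : List A → ℕ → A → Set
  ChainFrom xs i x = ∃[ c ] length c ≡ i × AllPairs Q (x ∷ c) × (x ∷ c) ⊆ xs

  -- `nonempty` keeps what nonemptiness is wanted for: one chain of `suc i` elements, to be read off
  -- from the last layer.
  record Layer (xs : List A) (i : ℕ) (l : List A) : Set where
    field
      clique   : AllPairs P l
      sublist  : l ⊆ xs
      chains   : All (ChainFrom xs i) l
      nonempty : ∃[ x ] ChainFrom xs i x

  open Layer

  data Layers (xs : List A) (i : ℕ) : List (List A) → Set where
    []  : Layers xs i []
    _∷_ : ∀ {l ls} → Layer xs i l → Layers xs (suc i) ls → Layers xs i (l ∷ ls)

  ChainFrom-∷ʳ : ∀ {xs i x y} → ChainFrom xs i x → ChainFrom (y ∷ xs) i x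
  ChainFrom-∷ʳ (c , len , q , τ) = c , len , q , _ ∷ʳ τ

  Layer-∷ʳ : ∀ {xs i l x} → Layer xs i l → Layer (x ∷ xs) i l
  Layer-∷ʳ L = record
    { clique   = clique L
    ; sublist  = _ ∷ʳ sublist L
    ; chains   = All.map ChainFrom-∷ʳ (chains L)
    ; nonempty = map₂ ChainFrom-∷ʳ (nonempty L)
    }

  Layers-∷ʳ : ∀ {xs i ls x} → Layers xs i ls → Layers (x ∷ xs) i ls
  Layers-∷ʳ []       = []
  Layers-∷ʳ (L ∷ Ls) = Layer-∷ʳ L ∷ Layers-∷ʳ Ls

  -- Transitivity of `Q` carries `Q x y` along the chain from `y`, which relates `x` to all of its
  -- elements.
  extend : ∀ {xs i x y} → Q x y → ChainFrom xs i y → ChainFrom (x ∷ xs) (suc i) x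
  extend Qxy (c , len , q ∷ qs , τ) =
    _ , cong suc len , (Qxy ∷ All.map (Q-trans Qxy) q) ∷ q ∷ qs , refl ∷ τ

  -- x goes into the first layer containing no y with Q x y; each layer that is
  -- passed supplies a longer chain from x.
  insert : ∀ {xs i ls x} → All (λ y → P x y ⊎ Q x y) xs → ChainFrom (x ∷ xs) i x →
           Layers xs i ls →
           ∃[ ls′ ] Layers (x ∷ xs) i ls′ × length (concat ls′) ≡ suc (length (concat ls))
  insert pq c [] = _ , record
    { clique   = [] ∷ []
    ; sublist  = refl ∷ minimum _
    ; chains   = c ∷ []
    ; nonempty = _ , c
    } ∷ [] , refl
  insert {ls = l ∷ ls} pq c (L ∷ Ls) with All-⊎ (All-resp-⊆ (sublist L) pq)
  ... | inj₁ p = _ , record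
    { clique   = p ∷ clique L
    ; sublist  = refl ∷ sublist L
    ; chains   = c ∷ All.map ChainFrom-∷ʳ (chains L)
    ; nonempty = _ , c
    } ∷ Layers-∷ʳ Ls , refl
  ... | inj₂ q with insert pq (All.lookupWith (flip extend) (chains L) q) Ls
  ...   | ls′ , Ls′ , eq = l ∷ ls′ , Layer-∷ʳ L ∷ Ls′ , length-eq
    where
    open ≡.≡-Reasoning
    length-eq : length (l ++ concat ls′) ≡ suc (length (l ++ concat ls))
    length-eq = begin
      length (l ++ concat ls′)             ≡⟨ length-++ l ⟩
      length l + length (concat ls′)       ≡⟨ cong (length l +_) eq ⟩
      length l + suc (length (concat ls))  ≡⟨ ℕ.+-suc (length l) _ ⟩
      suc (length l + length (concat ls))  ≡⟨ cong suc (length-++ l) ⟨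
      suc (length (l ++ concat ls))        ∎

  -- Elements are inserted from the last to the first, so each new `x` precedes all those already
  -- placed and goes in front of chains and layers. It starts with the chain of `x` alone, as layer
  -- 0 asks.
  layers : ∀ {xs} → AllPairs (λ x y → P x y ⊎ Q x y) xs →
           ∃[ ls ] Layers xs 0 ls × length (concat ls) ≡ length xs
  layers []         = [] , [] , refl
  layers (pq ∷ pqs) with layers pqs
  ... | ls , Ls , eq with insert pq ([] , refl , [] ∷ [] , refl ∷ minimum _) Ls
  ...   | ls′ , Ls′ , eq′ = ls′ , Ls′ , trans eq′ (cong suc eq)

  Chain Clique : List A → List A → Set
  Chain  xs c = AllPairs Q c × c ⊆ xs
  Clique xs l = AllPairs P l × l ⊆ xs

  longestChain : ∀ {xs i l ls} → Layers xs i (l ∷ ls) →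
                 ∃[ c ] Chain xs c × length c ≡ i + length (l ∷ ls)
  longestChain {i = i} (L ∷ []) with nonempty L
  -- The last layer, of index `i`, has a chain with `i` elements after `x`; counting `x` gives
  -- `i + 1`.
  ... | x , c , refl , q , τ = x ∷ c , (q , τ) , ℕ.+-comm 1 i
  longestChain {i = i} (_ ∷ Ls@(_ ∷ _)) with longestChain Ls
  ... | c , C , eq = c , C , trans eq (≡.sym (ℕ.+-suc i _))

  chain : ∀ {xs ls} → Layers xs 0 ls → ∃[ c ] Chain xs c × length c ≡ length ls
  chain []          = [] , ([] , minimum _) , refl
  chain Ls@(_ ∷ _)  = longestChain Ls

  -- The longest layer serves: the total is at most the number of layers times the largest length.
  -- In the induction, `m` is the best choice among the later layers.
  largestClique : ∀ {xs i ls} → Layers xs i ls →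
                  ∃[ l ] Clique xs l × length (concat ls) ≤ length ls * length l
  largestClique []                    = [] , ([] , minimum _) , z≤n
  largestClique {ls = l ∷ ls} (L ∷ Ls) with largestClique Ls
  ... | m , M , bound with ℕ.≤-total (length l) (length m)
  ...   | inj₁ l≤m = m , M , (begin
    length (l ++ concat ls)             ≡⟨ length-++ l ⟩
    length l + length (concat ls)       ≤⟨ ℕ.+-mono-≤ l≤m bound ⟩
    length m + length ls * length m     ∎)
    where open ℕ.≤-Reasoning
  ...   | inj₂ m≤l = l , (clique L , sublist L) , (begin
    length (l ++ concat ls)             ≡⟨ length-++ l ⟩
    length l + length (concat ls)       ≤⟨ ℕ.+-monoʳ-≤ (length l) bound ⟩
    length l + length ls * length m     ≤⟨ ℕ.+-monoʳ-≤ (length l) (ℕ.*-monoʳ-≤ (length ls) m≤l) ⟩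
    length l + length ls * length l     ∎)
    where open ℕ.≤-Reasoning

  chain×clique : ∀ {xs} → AllPairs (λ x y → P x y ⊎ Q x y) xs →
                 ∃[ c ] ∃[ l ] Chain xs c × Clique xs l × length xs ≤ length c * length l
  chain×clique pqs with layers pqs
  ... | ls , Ls , eq with chain Ls | largestClique Ls
  ...   | c , C , c≡ls | l , L , bound = c , l , C , L , (begin
    _                     ≡⟨ eq ⟨
    length (concat ls)    ≤⟨ bound ⟩
    length ls * length l  ≡⟨ cong (_* length l) c≡ls ⟨
    length c * length l   ∎)
    where open ℕ.≤-Reasoning

open Layering using (chain×clique)

-- Edges, their mutual positions, and the three patterns.

module _ {m : ℕ} where

  -- Nests and Crosses have their intended meaning only for e and f with left e < left f.
  Before Precedes Nests Crosses : Rel (Edge m) 0ℓ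
  Before   e f = left e < left f × VertexDisjoint e f
  Precedes e f = right e < left f
  Nests    e f = right f < right e
  Crosses  e f = left f < right e × right e < right f

  Precedes-trans : Transitive Precedes
  Precedes-trans {_} {f} e<f f<g = Fin.<-trans (Fin.<-trans e<f (left<right f)) f<g

  Nests-trans : Transitive Nests
  Nests-trans e⊃f f⊃g = Fin.<-trans f⊃g e⊃f

  -- Disjointness rules out the two ties `right e ≡ left f` and `right e ≡ right f`. The sum is
  -- bracketed for the first layering: precedence makes the chains, and the other two cases together
  -- make the cliques.
  trichotomy : ∀ {e f} → Before e f → (Crosses e f ⊎ Nests e f) ⊎ Precedes e f
  trichotomy {e} {f} (_ , e#f) with Fin.<-cmp (right e) (left f) | Fin.<-cmp (right e) (right f)
  ... | tri< e<f _ _ | _            = inj₂ e<f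
  ... | tri≈ _ eq _  | _            = contradiction (there (here refl) , here eq) e#f
  ... | tri> _ _ _   | tri≈ _ eq _  = contradiction (there (here refl) , there (here eq)) e#f
  ... | tri> _ _ f<e | tri< e<f _ _ = inj₁ (inj₁ (f<e , e<f))
  ... | tri> _ _ _   | tri> _ _ f<e = inj₁ (inj₂ f<e)

  byLeft : DecTotalOrder 0ℓ 0ℓ 0ℓ
  byLeft = On.decTotalOrder (Fin.≤-decTotalOrder m) left

  -- Sorting gives only `≤` between left endpoints; disjointness makes it strict. Disjointness
  -- survives the reordering because it is symmetric.
  sort-Before : ∀ {es} → AllPairs VertexDisjoint es → AllPairs Before (sort byLeft es)
  sort-Before {es} #es = AllPairs.zipWith
    (λ (e≤f , e#f) → Fin.≤∧≢⇒< e≤f (λ eq → e#f (here refl , here eq)) , e#f)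
    ( Linked⇒AllPairs Fin.≤-trans (sort-↗ byLeft es)
    , AllPairs-resp-↭ (setoid _) sym (resp₂ VertexDisjoint) (↭⇒↭ₛ (↭-sym (sort-↭ byLeft es))) #es)

  module _ {c : List (Edge m)} (before : AllPairs Before c) where

    toMatching : Matching m (length c)
    toMatching = record { edges = c ; size = refl ; disjoint = AllPairs.map proj₂ before }

    lefts : AllPairs (_<_ on left) c
    lefts = AllPairs.map proj₁ before

    numbering : IsNumbering toMatching c
    numbering = ↭-refl , AllPairs⇒Linked (AllPairs.map⁺ lefts)

    line : AllPairs Precedes c → IsLine toMatching
    line prec = c , numbering , AllPairs⇒Linked (AllPairs.concat⁺
      (All.map⁺ (All.universal (λ e → (left<right e ∷ []) ∷ [] ∷ []) c))
      (AllPairs.map⁺ (AllPairs.map (λ {e} {f} → separated {e} {f}) prec)))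
      where
      -- The single inequality `right e < left f` implies all four comparisons, since each edge has
      -- its left endpoint first.
      separated : ∀ {e f} → Precedes e f → All (λ v → All (v <_) (endpoints f)) (endpoints e)
      separated {e} {f} p =
        (Fin.<-trans (left<right e) p ∷ Fin.<-trans (left<right e) p′ ∷ []) ∷ (p ∷ p′ ∷ []) ∷ []
        where p′ = Fin.<-trans p (left<right f)

    -- Shared by stacks and waves. Within one edge, and from an earlier left endpoint to a later
    -- right one, the order is automatic; only `left f < right e` for a later `f` depends on `R`,
    -- through `meet`.
    left<rights : {R : Rel (Edge m) 0ℓ} → (∀ {e f} → left e < left f → R e f → left f < right e) →
                  AllPairs R c → All (λ v → All (v <_) (map right c)) (map left c)
    left<rights meet rs = All.map⁺ (All.map All.map⁺
      (AllPairs⇒All² (λ {e} → left<right e)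
        (λ {e} {f} (l , r) → Fin.<-trans l (left<right f) , meet l r)
        (AllPairs.zip (lefts , rs))))

    stack : AllPairs Nests c → IsStack toMatching
    stack nests = c , numbering , AllPairs⇒Linked (AllPairs.++⁺
      (AllPairs.map⁺ lefts)
      -- Nesting makes the right endpoints decrease, so their reversal increases.
      (AllPairs-reverse⁺ (AllPairs.map⁺ nests))
      (All.map (All-resp-↭ (↭-sym (↭-reverse (map right c))))
        (left<rights (λ {e} {f} _ → Fin.<-trans (left<right f)) nests)))

    wave : AllPairs Crosses c → IsWave toMatching
    wave crosses = c , numbering , AllPairs⇒Linked (AllPairs.++⁺
      (AllPairs.map⁺ lefts)
      (AllPairs.map⁺ (AllPairs.map proj₂ crosses))
      (left<rights (λ _ → proj₁) crosses))

  chain×chain×clique : ∀ {es} → AllPairs Before es →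
    ∃[ as ] ∃[ bs ] ∃[ cs ]
      (AllPairs Precedes as × as ⊆ es) × (AllPairs Nests bs × bs ⊆ es) × (AllPairs Crosses cs × cs ⊆ es) ×
      length es ≤ length as * (length bs * length cs)
  chain×chain×clique before
    with chain×clique (λ {e} {f} {g} → Precedes-trans {e} {f} {g}) (AllPairs.map (λ {e} {f} → trichotomy {e} {f}) before)
  ... | as , ds , A , (meet , ds⊆) , es≤
      -- Any two elements of `ds` cross or nest, so nesting can now make the chains; sublists of
      -- `ds` are sublists of `es`.
      with chain×clique (λ {e} {f} {g} → Nests-trans {e} {f} {g}) meet
  ...   | bs , cs , (nest , bs⊆) , (cross , cs⊆) , ds≤ =
    as , bs , cs , A , (nest , ⊆-trans bs⊆ ds⊆) , (cross , ⊆-trans cs⊆ ds⊆) ,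
    ℕ.≤-trans es≤ (ℕ.*-monoʳ-≤ (length as) ds≤)

  isSubMatching : ∀ {n ds es} (M : Matching m n) → es ↭ edges M → (τ : ds ⊆ es) (before : AllPairs Before es) →
                  IsSubMatching (toMatching (AllPairs-resp-⊇ τ before)) M
  isSubMatching _ es↭ τ _ = Any-resp-↭ es↭ ∘ lookup τ

  line×stack×wave : ∀ {n es} (M : Matching m n) → es ↭ edges M → AllPairs Before es →
    ∃[ a ] ∃[ b ] ∃[ c ] n ≤ a * (b * c) × ContainsLine a M × ContainsStack b M × ContainsWave c M
  line×stack×wave M es↭ before with chain×chain×clique before
  ... | as , bs , cs , (prec , as⊆) , (nest , bs⊆) , (cross , cs⊆) , es≤ =
    length as , length bs , length cs ,
    subst (_≤ length as * (length bs * length cs)) (trans (↭-length es↭) (size M)) es≤ ,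
    (toMatching (inherit as⊆) , isSubMatching M es↭ as⊆ before , line (inherit as⊆) prec) ,
    (toMatching (inherit bs⊆) , isSubMatching M es↭ bs⊆ before , stack (inherit bs⊆) nest) ,
    (toMatching (inherit cs⊆) , isSubMatching M es↭ cs⊆ before , wave (inherit cs⊆) cross)
    where
    inherit : ∀ {ds} → ds ⊆ _ → AllPairs Before ds
    inherit τ = AllPairs-resp-⊇ τ before

-- From the product of three sizes to a cube.

product≤cube : ∀ {a b c k} → a ≤ k → b ≤ k → c ≤ k → a * (b * c) ≤ k ^ 3
product≤cube {k = k} a≤k b≤k c≤k =
  -- `k ^ 3` unfolds to `k * (k * (k * 1))`, so the last factor is compared with `k * 1`.
  ℕ.*-mono-≤ a≤k (ℕ.*-mono-≤ b≤k (ℕ.≤-trans c≤k (ℕ.≤-reflexive (≡.sym (ℕ.*-identityʳ k)))))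

-- `n ≤ k ^ 3` states that `k` is at least the cube root of `n`, within the natural numbers. The
-- largest factor is taken as `k` together with its own predicate, so no pattern has to be resized.
largestFactor : ∀ {n} {A B C : Pred ℕ 0ℓ} → ∃[ a ] ∃[ b ] ∃[ c ] n ≤ a * (b * c) × A a × B b × C c →
                ∃[ k ] n ≤ k ^ 3 × (A k ⊎ B k ⊎ C k)
largestFactor (a , b , c , n≤abc , A , B , C)
  with ℕ.≤-total a b | ℕ.≤-total b c | ℕ.≤-total a c
... | inj₁ a≤b | inj₂ c≤b | _        =
  b , ℕ.≤-trans n≤abc (product≤cube a≤b ℕ.≤-refl c≤b) , inj₂ (inj₁ B)
... | inj₁ a≤b | inj₁ b≤c | _        =
  c , ℕ.≤-trans n≤abc (product≤cube (ℕ.≤-trans a≤b b≤c) b≤c ℕ.≤-refl) , inj₂ (inj₂ C)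
... | inj₂ b≤a | _        | inj₂ c≤a =
  a , ℕ.≤-trans n≤abc (product≤cube ℕ.≤-refl b≤a c≤a) , inj₁ A
... | inj₂ b≤a | _        | inj₁ a≤c =
  c , ℕ.≤-trans n≤abc (product≤cube a≤c (ℕ.≤-trans b≤a a≤c) ℕ.≤-refl) , inj₂ (inj₂ C)

corollary3 : ∀ (n : ℕ) .{{_ : NonZero n}} (M : OrderedMatching n) →
    ∃[ k ] n ≤ k ^ 3 × (ContainsLine k M ⊎ ContainsStack k M ⊎ ContainsWave k M)
corollary3 n M = largestFactor
  (line×stack×wave M (sort-↭ (byLeft {2 * n}) (edges M)) (sort-Before (disjoint M)))
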